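{- If $G$ is an AT-free graph, then $\mathrm{cub}(G)\le 3\Delta-1$, where $\Delta$ is the maximum degree of $G$ and $\mathrm{cub}(G)$ denotes the cubicity of $G$.
   Context: All graphs are simple, finite and undirected. Cubicity: a $k$-cube is a Cartesian product $R_1\times\cdots\times R_k$ where each $R_i$ is a closed interval of the form $[a_i,a_i+1]$ on the real line. The cubicity $\mathrm{cub}(G)$ is the minimum $k$ such that each vertex of $G$ can be mapped to a $k$-cube so that two distinct vertices are adjacent in $G$ if and only if their $k$-cubes have non-empty intersection. An asteroidal triple in a graph is a set of three pairwise non-adjacent vertices such that between every two of them there is a path that contains neither the third vertex nor any neighbour of the third vertex. A graph is AT-free if it contains no asteroidal triple.
   Formalization: The formal theorem assumes that the maximum degree Δ is at least 1; for edgeless graphs (Δ = 0), which are AT-free, the stated bound 3Δ−1 = −1 is false because cubicity is nonnegative. -}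

module Defs where

open import Level using (0ℓ)
open import Data.Empty using (⊥; ⊥-elim)
open import Data.Fin.Base using (Fin)
open import Data.Fin.Properties using (_≟_)
open import Data.List.Base using (List; length; map; filter; allFin; head; last)
open import Data.List.Extrema.Nat using (max)
open import Data.List.Relation.Unary.All using (All)
open import Data.List.Relation.Unary.Linked using (Linked)
open import Data.List.Relation.Unary.Unique.Propositional using (Unique)
open import Data.Maybe.Base using (just)
open import Data.Nat.Base as ℕ using (ℕ)
import Data.Nat.Induction as ℕ
import Data.Nat.Properties as ℕ
open import Data.Product.Base using (Σ; ∃; ∃-syntax; _×_; _,_; proj₁; proj₂)
open import Data.Rational.Base using (ℚ; 0ℚ; 1ℚ; _+_; _-_; -_; _<_; _≤_)
open import Data.Rational.Properties hiding (_≟_)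
open import Data.Sum.Base using (_⊎_; inj₁; inj₂)
open import Data.Vec.Functional using (Vector)
open import Function.Bundles using (_⇔_; mk⇔)
open import Relation.Binary.Core using (Rel)
open import Relation.Binary.Definitions
  using (Decidable; Symmetric; Irreflexive)
open import Relation.Binary.PropositionalEquality
  using (_≡_; _≢_; refl; sym; trans; cong; subst)
open import Relation.Nullary.Decidable
  using (Dec; yes; no; _×-dec_; from-yes; from-no; decidable-stable)
open import Relation.Nullary.Negation using (¬_)

------------------------------------------------------------------------
-- Finite simple graphs

record Graph : Set₁ where
  field
    order      : ℕ
    Adj        : Rel (Fin order) 0ℓ
    adj?       : Decidable Adj
    Adj-sym    : Symmetric Adj
    Adj-irrefl : Irreflexive _≡_ Adj

  Vertex : Set
  Vertex = Fin order

  degree : Vertex → ℕ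
  degree v = length (filter (adj? v) (allFin order))

  -- Equal to 0 for the graph with no vertices.
  Δ : ℕ
  Δ = max 0 (map degree (allFin order))

open Graph public using (Δ)

------------------------------------------------------------------------
-- Asteroidal triples

module _ (G : Graph) where
  open Graph G

  record Path (u v : Vertex) : Set where
    field
      vertices : List Vertex
      starts   : head vertices ≡ just u
      ends     : last vertices ≡ just v
      linked   : Linked Adj vertices
      unique   : Unique vertices

  PathAvoidingNbhd : (u v w : Vertex) → Set
  PathAvoidingNbhd u v w =
    Σ (Path u v) λ p → All (λ x → x ≢ w × ¬ Adj x w) (Path.vertices p)

  record IsAsteroidalTriple (x y z : Vertex) : Set where
    field
      x≢y  : x ≢ y
      y≢z  : y ≢ z
      x≢z  : x ≢ z
      ¬x~y : ¬ Adj x y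
      ¬y~z : ¬ Adj y z
      ¬x~z : ¬ Adj x z
      xy   : PathAvoidingNbhd x y z
      yz   : PathAvoidingNbhd y z x
      xz   : PathAvoidingNbhd x z y

  ATFree : Set
  ATFree = ∀ x y z → ¬ IsAsteroidalTriple x y z

------------------------------------------------------------------------
-- Real numbers, as Dedekind cuts

record ℝ : Set₁ where
  field
    L U       : ℚ → Set
    L-inhab   : ∃ L
    U-inhab   : ∃ U
    L-lower   : ∀ {q r} → q < r → L r → L q
    U-upper   : ∀ {q r} → q < r → U q → U r
    L-rounded : ∀ {q} → L q → ∃[ r ] q < r × L r
    U-rounded : ∀ {r} → U r → ∃[ q ] q < r × U q
    disjoint  : ∀ {q} → L q → U q → ⊥
    located   : ∀ {q r} → q < r → L q ⊎ U r

infix 4 _≤ᴿ_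
_≤ᴿ_ : ℝ → ℝ → Set
x ≤ᴿ y = ∀ q → ℝ.L x q → ℝ.L y q

private
  q+s-s : ∀ q s → (q + s) - s ≡ q
  q+s-s q s = trans (+-assoc q s (- s))
    (trans (cong (q +_) (+-inverseʳ s)) (+-identityʳ q))

  q-s+s : ∀ q s → (q - s) + s ≡ q
  q-s+s q s = trans (+-assoc q (- s) s)
    (trans (cong (q +_) (+-inverseˡ s)) (+-identityʳ q))

  shift< : ∀ {q r} s → q - s < r → q < r + s
  shift< {q} s lt = subst (_< _) (q-s+s q s) (+-monoˡ-< s lt)

  shift> : ∀ {q r} s → r < q - s → r + s < q
  shift> {q} s lt = subst (_ <_) (q-s+s q s) (+-monoˡ-< s lt)

infixl 6 _+ᴿ_
_+ᴿ_ : ℝ → ℚ → ℝ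
x +ᴿ s = record
  { L         = λ q → L (q - s)
  ; U         = λ q → U (q - s)
  ; L-inhab   = let q , l = L-inhab in q + s , back L l
  ; U-inhab   = let q , u = U-inhab in q + s , back U u
  ; L-lower   = λ q<r → L-lower (+-monoˡ-< (- s) q<r)
  ; U-upper   = λ q<r → U-upper (+-monoˡ-< (- s) q<r)
  ; L-rounded = λ l → let r , q<r , l′ = L-rounded l in r + s , shift< s q<r , back L l′
  ; U-rounded = λ u → let q , q<r , u′ = U-rounded u in q + s , shift> s q<r , back U u′
  ; disjoint  = disjoint
  ; located   = λ q<r → located (+-monoˡ-< (- s) q<r)
  }
  where
  open ℝ x
  back : ∀ (P : ℚ → Set) {q} → P q → P ((q + s) - s)
  back P = subst P (sym (q+s-s _ s))

------------------------------------------------------------------------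
-- Cubicity

_∈[_,_] : ℝ → ℝ → ℝ → Set
x ∈[ a , b ] = a ≤ᴿ x × x ≤ᴿ b

-- A k-cube is given by the vector of left end points of its factors.
_∈Cube_ : ∀ {k} → Vector ℝ k → Vector ℝ k → Set
p ∈Cube a = ∀ i → p i ∈[ a i , a i +ᴿ 1ℚ ]

CubesMeet : ∀ {k} → Vector ℝ k → Vector ℝ k → Set₁
CubesMeet a b = ∃[ p ] p ∈Cube a × p ∈Cube b

CubeRepresentable : Graph → ℕ → Set₁
CubeRepresentable G k =
  Σ (Vertex → Vector ℝ k) λ cube →
    ∀ u v → u ≢ v → Adj u v ⇔ CubesMeet (cube u) (cube v)
  where open Graph G

IsCubicity : Graph → ℕ → Set₁
IsCubicity G c =
  CubeRepresentable G c × (∀ k → CubeRepresentable G k → c ℕ.≤ k)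

------------------------------------------------------------------------
-- Every graph has a cube representation, so the minimum defining its
-- cubicity is taken over a nonempty set.

fromℚ : ℚ → ℝ
fromℚ a = record
  { L         = _< a
  ; U         = a <_
  ; L-inhab   = a - 1ℚ , a-1<a
  ; U-inhab   = a + 1ℚ , a<a+1
  ; L-lower   = <-trans
  ; U-upper   = λ q<r a<q → <-trans a<q q<r
  ; L-rounded = λ q<a → <-dense q<a
  ; U-rounded = λ a<r → let q , a<q , q<r = <-dense a<r in q , q<r , a<q
  ; disjoint  = <-asym
  ; located   = loc
  }
  where
  a<a+1 : a < a + 1ℚ
  a<a+1 = subst (_< a + 1ℚ) (+-identityʳ a) (+-monoʳ-< a (from-yes (0ℚ <? 1ℚ)))
  a-1<a : a - 1ℚ < a
  a-1<a = subst (a - 1ℚ <_) (+-identityʳ a) (+-monoʳ-< a (from-yes (- 1ℚ <? 0ℚ)))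
  loc : ∀ {q r} → q < r → q < a ⊎ a < r
  loc {q} q<r with q <? a
  ... | yes q<a = inj₁ q<a
  ... | no  q≮a = inj₂ (≤-<-trans (≮⇒≥ q≮a) q<r)

fromℚ-mono : ∀ {a b} → a ≤ b → fromℚ a ≤ᴿ fromℚ b
fromℚ-mono a≤b _ q<a = <-≤-trans q<a a≤b

fromℚ-cancel : ∀ {a b} → fromℚ a ≤ᴿ fromℚ b → a ≤ b
fromℚ-cancel le = ≮⇒≥ λ b<a → <-irrefl refl (le _ b<a)

fromℚ-+⁺ : ∀ {a b} s → a ≤ b + s → fromℚ a ≤ᴿ fromℚ b +ᴿ s
fromℚ-+⁺ {b = b} s a≤b+s _ q<a =
  subst (_ <_) (q+s-s b s) (+-monoˡ-< (- s) (<-≤-trans q<a a≤b+s))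

fromℚ-+⁻ : ∀ {a b} s → fromℚ a ≤ᴿ fromℚ b +ᴿ s → a ≤ b + s
fromℚ-+⁻ s le = ≮⇒≥ λ b+s<a → <-irrefl refl (shift< s (le _ b+s<a))

-- One coordinate per vertex i, placing i at 0, its neighbours at 1 and
-- all other vertices at 2.
cubeRepresentable-order : ∀ G → CubeRepresentable G (Graph.order G)
cubeRepresentable-order G = (λ v i → fromℚ (pos i v)) , λ u v u≢v →
  mk⇔ (λ u~v → (λ i → fromℚ (proj₁ (meet u~v i)))
             , (λ i → let _ , (l , h) , _ = meet u~v i in fromℚ-mono l , fromℚ-+⁺ 1ℚ h)
             , (λ i → let _ , _ , (l , h) = meet u~v i in fromℚ-mono l , fromℚ-+⁺ 1ℚ h))
      (λ where (p , p∈u , p∈v) → decidable-stable (adj? u v) λ u≁v →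
                 apart u≢v u≁v (fromℚ-+⁻ 1ℚ
                   (λ q q<v → proj₂ (p∈u u) q (proj₁ (p∈v u) q q<v))))
  where
  open Graph G
  2ℚ = 1ℚ + 1ℚ

  pos : Vertex → Vertex → ℚ
  pos i v with i ≟ v | adj? i v
  ... | yes _ | _     = 0ℚ
  ... | no _  | yes _ = 1ℚ
  ... | no _  | no _  = 2ℚ

  _∈I_ : ℚ → ℚ → Set
  q ∈I a = a ≤ q × q ≤ a + 1ℚ

  ∈I? : ∀ q a → Dec (q ∈I a)
  ∈I? q a = (a ≤? q) ×-dec (q ≤? a + 1ℚ)

  meet : ∀ {u v} → Adj u v → ∀ i → ∃[ q ] q ∈I pos i u × q ∈I pos i v
  meet {u} {v} u~v i with i ≟ u | adj? i u | i ≟ v | adj? i v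
  ... | yes refl | _     | yes refl | _      = ⊥-elim (Adj-irrefl refl u~v)
  ... | yes refl | _     | no _     | yes _  = 1ℚ , from-yes (∈I? 1ℚ 0ℚ) , from-yes (∈I? 1ℚ 1ℚ)
  ... | yes refl | _     | no _     | no u≁v = ⊥-elim (u≁v u~v)
  ... | no _     | yes _ | yes refl | _      = 1ℚ , from-yes (∈I? 1ℚ 1ℚ) , from-yes (∈I? 1ℚ 0ℚ)
  ... | no _     | no ¬a | yes refl | _      = ⊥-elim (¬a (Adj-sym u~v))
  ... | no _     | yes _ | no _     | yes _  = 2ℚ , from-yes (∈I? 2ℚ 1ℚ) , from-yes (∈I? 2ℚ 1ℚ)
  ... | no _     | yes _ | no _     | no _   = 2ℚ , from-yes (∈I? 2ℚ 1ℚ) , from-yes (∈I? 2ℚ 2ℚ)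
  ... | no _     | no _  | no _     | yes _  = 2ℚ , from-yes (∈I? 2ℚ 2ℚ) , from-yes (∈I? 2ℚ 1ℚ)
  ... | no _     | no _  | no _     | no _   = 2ℚ , from-yes (∈I? 2ℚ 2ℚ) , from-yes (∈I? 2ℚ 2ℚ)

  apart : ∀ {u v} → u ≢ v → ¬ Adj u v → ¬ (pos u v ≤ pos u u + 1ℚ)
  apart {u} {v} u≢v u≁v le with u ≟ u | u ≟ v | adj? u v
  ... | no u≢u | _       | _       = u≢u refl
  ... | yes _  | yes u≡v | _       = u≢v u≡v
  ... | yes _  | no _    | yes u~v = u≁v u~v
  ... | yes _  | no _    | no _    = from-no (2ℚ ≤? 0ℚ + 1ℚ) le

¬¬cubicity : ∀ G → ¬ ¬ ∃ (IsCubicity G)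
¬¬cubicity G none = noRep (Graph.order G) (cubeRepresentable-order G)
  where
  noRep : ∀ k → ¬ CubeRepresentable G k
  noRep = ℕ.<-rec _ λ k rec rep →
    none (k , rep , λ j rep′ → ℕ.≮⇒≥ λ j<k → rec j<k rep′)

{-# OPTIONS --safe #-}

-- An ordering of the vertices in which adjacent vertices have ranks at most
-- b apart yields b + 1 unit-interval coordinates: one per residue class mod b,
-- separating each vertex of the class from its non-neighbours among the next
-- b - 1 vertices, and one separating non-adjacent vertices at rank distance
-- b or more.
--
-- For AT-free G an ordering with b = 3Δ - 2 comes from a walk on which every
-- vertex of a component has a foot, itself or a neighbour, so that adjacent
-- vertices have feet at most 2 apart. Ordering the vertices by their feet,
-- the interval spanned by an edge lies in N[a] ∪ N[b] ∪ N[c] for three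
-- consecutive vertices a, b, c of the walk, which has at most 3Δ - 1 elements.
--
-- The walk starts in the last distance level from a vertex x that maximizes
-- the component C of r in G - N[x], and descends to x, each time to a lower
-- neighbour having itself the fewest lower neighbours. The absence of
-- asteroidal triples {x, u, v} makes the sets of lower neighbours of
-- non-adjacent u, v ∈ C of equal level nested; hence each vertex of C is near
-- the walk's vertex of its own level or adjacent to that of the level below.

module Submission where

open import Defs

open import Algebra.Properties.CommutativeSemigroup using (xy∙z≈xz∙y; xy∙z≈y∙xz)
open import Data.Empty using (⊥)
open import Data.Fin.Base using (Fin; zero; suc; toℕ)
open import Data.Fin.Properties using (_≟_; any?; sequence; toℕ<n; toℕ-fromℕ<; toℕ-injective)
import Data.Integer.Base as ℤ
import Data.Integer.Properties as ℤ
open import Data.List.Base using (List; []; _∷_; _++_; allFin; filter; last; length; map)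
open import Data.List.Extrema.Nat
  using (argmax; argmax-all; argmin; argmin-all; f[argmin]≤f[xs]; f[xs]≤f[argmax]; max; xs≤max)
open import Data.List.Membership.DecPropositional using (_∈?_)
open import Data.List.Membership.Propositional using (_∈_; _∉_)
open import Data.List.Membership.Propositional.Properties
  using (∈-∃++; ∈-++⁺ʳ; ∈-++⁺ˡ; ∈-++⁻; ∈-allFin; ∈-filter⁺; ∈-filter⁻; ∈-map⁺)
open import Data.List.Properties using (length-++; length-filter; length-tabulate)
open import Data.List.Relation.Binary.Subset.Propositional using (_⊆_)
open import Data.List.Relation.Unary.All as All using (All; []; _∷_)
import Data.List.Relation.Unary.All.Properties as All
open import Data.List.Relation.Unary.AllPairs using ([]; _∷_)
open import Data.List.Relation.Unary.Any using (here; there)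
open import Data.List.Relation.Unary.Linked using (Linked; [-]; _∷_)
open import Data.List.Relation.Unary.Unique.Propositional using (Unique)
import Data.List.Relation.Unary.Unique.Propositional.Properties as Unique
open import Data.Maybe.Base using (just)
open import Data.Nat.Base hiding (Ordering)
open import Data.Nat.DivMod
open import Data.Nat.Properties as ℕ hiding (_≟_)
open import Data.Nat.Tactic.RingSolver using (solve-∀)
open import Data.Product.Base using (∃; ∃₂; _×_; _,_; proj₁; proj₂; map₂)
open import Data.Rational.Base as ℚ using (ℚ; 1ℚ; toℚᵘ)
import Data.Rational.Properties as ℚ
open import Data.Rational.Unnormalised.Base as ℚᵘ using (mkℚᵘ; 1ℚᵘ; *≡*; *≤*)
import Data.Rational.Unnormalised.Properties as ℚᵘ
open import Data.Sum.Base using (_⊎_; inj₁; inj₂)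
open import Effect.Monad using (RawMonad)
open import Function.Base using (_∘_; id)
open import Function.Bundles using (mk⇔)
open import Level using (0ℓ)
open import Relation.Binary.Definitions using (tri<; tri≈; tri>)
open import Relation.Binary.PropositionalEquality
open import Relation.Nullary.Decidable
  using (Dec; yes; no; _×-dec_; _⊎-dec_; ¬?; decidable-stable; ¬¬-excluded-middle)
open import Relation.Nullary.Negation using (¬_; contradiction; ¬¬-Monad)
open import Relation.Unary using (Pred; Decidable; U)

-- Integer coordinates scaled to unit intervals

scaled : ℕ → ℕ → ℚ
scaled τ m = ℤ.+ m ℚ./ suc τ

-- Over the common denominator `suc τ`, comparing scaled values reduces to comparing numerators.
toℚᵘ-scaled : ∀ τ m → toℚᵘ (scaled τ m) ℚᵘ.≃ mkℚᵘ (ℤ.+ m) τ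
toℚᵘ-scaled τ m = ℚ.toℚᵘ-fromℚᵘ (mkℚᵘ (ℤ.+ m) τ)

toℚᵘ-scaled-+1 : ∀ τ m → toℚᵘ (scaled τ m ℚ.+ 1ℚ) ℚᵘ.≃ mkℚᵘ (ℤ.+ (m + suc τ)) τ
toℚᵘ-scaled-+1 τ m = begin-equality
  toℚᵘ (scaled τ m ℚ.+ 1ℚ)      ≃⟨ ℚ.toℚᵘ-homo-+ (scaled τ m) 1ℚ ⟩
  toℚᵘ (scaled τ m) ℚᵘ.+ 1ℚᵘ    ≃⟨ ℚᵘ.+-congˡ 1ℚᵘ (toℚᵘ-scaled τ m) ⟩
  mkℚᵘ (ℤ.+ m) τ ℚᵘ.+ 1ℚᵘ         ≃⟨ *≡* (cong₂ ℤ._*_ numerator (cong ℤ.+_ (sym (*-identityʳ (suc τ))))) ⟩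
  mkℚᵘ (ℤ.+ (m + suc τ)) τ        ∎
  where
  open ℚᵘ.≤-Reasoning
  numerator : ℤ.+ m ℤ.* ℤ.+ 1 ℤ.+ ℤ.+ 1 ℤ.* ℤ.+ suc τ ≡ ℤ.+ (m + suc τ)
  numerator = trans (cong₂ ℤ._+_ (ℤ.*-identityʳ (ℤ.+ m)) (ℤ.*-identityˡ (ℤ.+ suc τ)))
                    (sym (ℤ.pos-+ m (suc τ)))

scaled-≤⁺ : ∀ τ {l m} → l ≤ m + suc τ → scaled τ l ℚ.≤ scaled τ m ℚ.+ 1ℚ
scaled-≤⁺ τ {l} {m} l≤m+T = ℚ.toℚᵘ-cancel-≤ (begin
  toℚᵘ (scaled τ l)          ≃⟨ toℚᵘ-scaled τ l ⟩
  mkℚᵘ (ℤ.+ l) τ               ≤⟨ *≤* (ℤ.*-monoʳ-≤-nonNeg (ℤ.+ suc τ) (ℤ.+≤+ l≤m+T)) ⟩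
  mkℚᵘ (ℤ.+ (m + suc τ)) τ     ≃⟨ toℚᵘ-scaled-+1 τ m ⟨
  toℚᵘ (scaled τ m ℚ.+ 1ℚ)   ∎)
  where open ℚᵘ.≤-Reasoning

scaled-≤⁻ : ∀ τ {l m} → scaled τ l ℚ.≤ scaled τ m ℚ.+ 1ℚ → l ≤ m + suc τ
scaled-≤⁻ τ {l} {m} le = ℤ.drop‿+≤+ (ℤ.*-cancelʳ-≤-pos _ _ (ℤ.+ suc τ) (ℚᵘ.drop-*≤* (begin
  mkℚᵘ (ℤ.+ l) τ               ≃⟨ toℚᵘ-scaled τ l ⟨
  toℚᵘ (scaled τ l)          ≤⟨ ℚ.toℚᵘ-mono-≤ le ⟩
  toℚᵘ (scaled τ m ℚ.+ 1ℚ)   ≃⟨ toℚᵘ-scaled-+1 τ m ⟩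
  mkℚᵘ (ℤ.+ (m + suc τ)) τ     ∎)))
  where open ℚᵘ.≤-Reasoning

module _ (G : Graph) where
  open Graph G using (Vertex; Adj; adj?; Adj-sym)

  -- Coordinate i is scaled so that the threshold suc (τ i) becomes 1.
  thresholds⇒cubes : ∀ k (τ : Fin k → ℕ) (f : Fin k → Vertex → ℕ) →
    (∀ i {u v} → Adj u v → f i v ≤ f i u + suc (τ i)) →
    (∀ {u v} → u ≢ v → ¬ Adj u v →
      ∃ λ i → f i u + suc (τ i) < f i v ⊎ f i v + suc (τ i) < f i u) →
    CubeRepresentable G k
  thresholds⇒cubes k τ f close far = (λ v i → fromℚ (pos v i)) , λ u v u≢v → mk⇔
    (λ u~v → (λ i → fromℚ (pos u i ℚ.⊔ pos v i))
           , (λ i → fromℚ-mono (ℚ.p≤p⊔q (pos u i) (pos v i))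
                  , fromℚ-+⁺ 1ℚ (ℚ.⊔-lub (self u i) (near i (Adj-sym u~v))))
           , (λ i → fromℚ-mono (ℚ.p≤q⊔p (pos u i) (pos v i))
                  , fromℚ-+⁺ 1ℚ (ℚ.⊔-lub (near i u~v) (self v i))))
    (λ where (p , p∈u , p∈v) → decidable-stable (adj? u v) λ u≁v → apart {u} {v} {p} p∈u p∈v (far u≢v u≁v))
    where
    pos : Vertex → Fin k → ℚ
    pos v i = scaled (τ i) (f i v)

    near : ∀ i {u v} → Adj u v → pos u i ℚ.≤ pos v i ℚ.+ 1ℚ
    near i u~v = scaled-≤⁺ (τ i) (close i (Adj-sym u~v))

    self : ∀ u i → pos u i ℚ.≤ pos u i ℚ.+ 1ℚ
    self u i = scaled-≤⁺ (τ i) (m≤m+n (f i u) (suc (τ i)))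

    common : ∀ {u v p} i → p ∈Cube (λ i → fromℚ (pos u i)) → p ∈Cube (λ i → fromℚ (pos v i)) →
             f i v ≤ f i u + suc (τ i)
    common i p∈u p∈v =
      scaled-≤⁻ (τ i) (fromℚ-+⁻ 1ℚ λ q → proj₂ (p∈u i) q ∘ proj₁ (p∈v i) q)

    apart : ∀ {u v p} → p ∈Cube (λ i → fromℚ (pos u i)) → p ∈Cube (λ i → fromℚ (pos v i)) →
            ¬ ∃ λ i → f i u + suc (τ i) < f i v ⊎ f i v + suc (τ i) < f i u
    apart {u} {v} {p} p∈u p∈v (i , inj₁ lt) = <⇒≱ lt (common {u} {v} {p} i p∈u p∈v)
    apart {u} {v} {p} p∈u p∈v (i , inj₂ lt) = <⇒≱ lt (common {v} {u} {p} i p∈v p∈u)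

-- Cube coordinates from an ordering of bounded bandwidth

[m+n]/n≡1+m/n : ∀ m n .{{_ : NonZero n}} → (m + n) / n ≡ suc (m / n)
[m+n]/n≡1+m/n m n = trans (m/n≡1+[m∸n]/n (m≤n+m n m)) (cong (λ k → suc (k / n)) (m+n∸n≡m m n))

m%n≡0⇒m≡m/n*n : ∀ m n .{{_ : NonZero n}} → m % n ≡ 0 → m ≡ m / n * n
m%n≡0⇒m≡m/n*n m n eq = trans (m≡m%n+[m/n]*n m n) (cong (_+ m / n * n) eq)

module _ (G : Graph) (b′ : ℕ) where
  open Graph G using (Vertex; Adj; adj?; Adj-sym; order)

  private
    b = suc b′

  -- Positions are cut into blocks of length `b`; a head, at the start of its block, is to be
  -- separated from its non-neighbours in that block.
  module ClassCoordinate
    (y : Vertex → ℕ)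
    (y-injective : ∀ {u v} → y u ≡ y v → u ≡ v)
    (y-close : ∀ {u v} → Adj u v → y v ≤ y u + b)
    where

    block : Vertex → ℕ
    block v = y v / b

    IsHead : Vertex → Set
    IsHead v = y v % b ≡ 0

    -- The vertex `u` can only be the head of the block of `v`. Heads themselves are `Missed` too,
    -- so `lag` tests for heads first.
    Missed : Vertex → Set
    Missed v = ∃ λ u → y u ≡ block v * b × ¬ Adj u v

    missed? : ∀ v → Dec (Missed v)
    missed? v = any? λ u → (y u ℕ.≟ block v * b) ×-dec ¬? (adj? u v)

    -- With threshold 2, a head is too far from exactly the lag-3 vertices of
    -- its block, while adjacent vertices of consecutive blocks stay close.
    lag : ∀ {H M : Set} → Dec H → Dec M → ℕ
    lag (yes _) _       = 0
    lag (no _)  (no _)  = 2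
    lag (no _)  (yes _) = 3

    value : Vertex → ℕ
    value v = lag (y v % b ℕ.≟ 0) (missed? v) + block v

    block-close : ∀ {u v} → Adj u v → block v ≤ suc (block u)
    block-close {u} {v} u~v =
      subst (block v ≤_) ([m+n]/n≡1+m/n (y u) b) (/-monoˡ-≤ b (y-close u~v))

    -- An edge from the head `u` reaches at most to the next multiple of `b`, where only a head can
    -- sit.
    block-after-head : ∀ {u v} → IsHead u → ¬ IsHead v → Adj u v → block v ≤ block u
    block-after-head {u} {v} hu ¬hv u~v with block v ≤? block u
    ... | yes le = le
    ... | no ¬le = contradiction (n≤0⇒n≡0 (+-cancelʳ-≤ (block v * b) (y v % b) 0 (begin
        y v % b + block v * b  ≡⟨ m≡m%n+[m/n]*n (y v) b ⟨
        y v                    ≤⟨ y-close u~v ⟩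
        y u + b                ≡⟨ +-comm (y u) b ⟩
        b + y u                ≡⟨ cong (b +_) (m%n≡0⇒m≡m/n*n (y u) b hu) ⟩
        suc (block u) * b      ≤⟨ *-monoˡ-≤ b (≰⇒> ¬le) ⟩
        block v * b            ∎))) ¬hv
      where open ≤-Reasoning

    value-close : ∀ {u v} → Adj u v → value v ≤ value u + 2
    value-close {u} {v} u~v with y v % b ℕ.≟ 0 | missed? v | y u % b ℕ.≟ 0 | missed? u
    ... | yes _ | _ | du | mu = begin
        block v                      ≤⟨ block-close u~v ⟩
        suc (block u)                ≤⟨ s≤s (m≤n+m (block u) (lag du mu)) ⟩
        suc (lag du mu + block u)    ≤⟨ n≤1+n _ ⟩
        2 + (lag du mu + block u)    ≡⟨ +-comm 2 (lag du mu + block u) ⟩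
        lag du mu + block u + 2      ∎
      where open ≤-Reasoning
    ... | no ¬hv | no _ | yes hu | _ =
        subst (_≤ block u + 2) (+-comm (block v) 2) (+-monoˡ-≤ 2 (block-after-head hu ¬hv u~v))
    -- In the same block, `u` would be the missed head `w`; hence `v` lies in an earlier block,
    -- which makes up for lag 3.
    ... | no ¬hv | yes (w , yw , w≁v) | yes hu | _ =
        subst (3 + block v ≤_) (+-comm 2 (block u))
          (s≤s (s≤s (≤∧≢⇒< (block-after-head hu ¬hv u~v) λ bv≡bu →
            w≁v (subst (λ w → Adj w v) (y-injective (sym (trans yw
              (trans (cong (_* b) bv≡bu) (sym (m%n≡0⇒m≡m/n*n (y u) b hu)))))) u~v))))
    -- Between non-heads, lag and block each grow by at most 1.
    ... | no ¬hv | mv | no ¬hu | mu = begin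
        lag (no ¬hv) mv + block v        ≤⟨ +-mono-≤ (lag≤3 mv) (block-close u~v) ⟩
        3 + suc (block u)                ≡⟨ regroup (block u) ⟩
        2 + block u + 2                  ≤⟨ +-monoˡ-≤ 2 (+-monoˡ-≤ (block u) (2≤lag mu)) ⟩
        lag (no ¬hu) mu + block u + 2    ∎
      where
      open ≤-Reasoning
      lag≤3 : ∀ {M : Set} (m : Dec M) → lag (no ¬hv) m ≤ 3
      lag≤3 (yes _) = ≤-refl
      lag≤3 (no _)  = n≤1+n 2
      2≤lag : ∀ {M : Set} (m : Dec M) → 2 ≤ lag (no ¬hu) m
      2≤lag (yes _) = n≤1+n 2
      2≤lag (no _)  = ≤-refl
      regroup : ∀ k → 3 + suc k ≡ 2 + k + 2
      regroup = solve-∀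

    block-of-head : ∀ {u v} → IsHead u → y u < y v → y v < y u + b → block v ≡ block u
    block-of-head {u} {v} hu u<v v<u+b = ≤-antisym
      (m<1+n⇒m≤n (m<n*o⇒m/o<n {n = suc (block u)}
        (subst (y v <_) (trans (+-comm (y u) b) (cong (b +_) (m%n≡0⇒m≡m/n*n (y u) b hu))) v<u+b)))
      (/-monoˡ-≤ b (<⇒≤ u<v))

    -- Both vertices are in the block headed by `u`, so `u` itself witnesses `Missed v`: the lags
    -- are 0 and 3.
    value-far : ∀ {u v} → IsHead u → ¬ Adj u v → y u < y v → y v < y u + b →
                value u + 2 < value v
    value-far {u} {v} hu u≁v u<v v<u+b
      with yu≡ ← trans (m%n≡0⇒m≡m/n*n (y u) b hu) (cong (_* b) (sym (block-of-head hu u<v v<u+b)))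
      with y u % b ℕ.≟ 0 | y v % b ℕ.≟ 0 | missed? v
    ... | no ¬hu | _      | _       = contradiction hu ¬hu
    ... | yes _  | yes hv | _       =
        contradiction (trans yu≡ (sym (m%n≡0⇒m≡m/n*n (y v) b hv))) (<⇒≢ u<v)
    ... | yes _  | no _   | no ¬m   = contradiction (u , yu≡ , u≁v) ¬m
    ... | yes _  | no _   | yes _   =
        subst (_< 3 + block v) (+-comm 2 (block u)) (+-monoʳ-≤ 3 (/-monoˡ-≤ b (<⇒≤ u<v)))

  module ChainCoordinate
    (pos : Vertex → ℕ)
    (pos-injective : ∀ {u v} → pos u ≡ pos v → u ≡ v)
    (pos-close : ∀ {u v} → Adj u v → pos v ≤ pos u + b)
    (M : ℕ) (pos<M : ∀ v → pos v < M)
    where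

    Gap : ℕ → Set
    Gap x = ∃₂ λ u v → pos u ≡ x × pos v ≡ x + b × ¬ Adj u v

    gap? : ∀ x → Dec (Gap x)
    gap? x = any? λ u → any? λ v → (pos u ℕ.≟ x) ×-dec (pos v ℕ.≟ x + b) ×-dec ¬? (adj? u v)

    jump : ∀ {P : Set} → Dec P → ℕ
    jump (yes _) = 1
    jump (no _)  = 0

    jump≤1 : ∀ {P : Set} (P? : Dec P) → jump P? ≤ 1
    jump≤1 (yes _) = ≤-refl
    jump≤1 (no _)  = z≤n

    -- The number of gaps on the chain r, r + b, …, r + k * b.
    gaps : ℕ → ℕ → ℕ
    gaps zero    r = 0
    gaps (suc k) r = jump (gap? (r + k * b)) + gaps k r

    gaps≤ : ∀ k r → gaps k r ≤ k
    gaps≤ zero    r = z≤n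
    gaps≤ (suc k) r = +-mono-≤ (jump≤1 (gap? (r + k * b))) (gaps≤ k r)

    -- The rank is scaled by M, which exceeds every drift, so drifts only matter
    -- for vertices at rank distance exactly b.
    drift : Vertex → ℕ
    drift v = gaps (pos v / b) (pos v % b)

    drift<M : ∀ v → drift v < M
    drift<M v = ≤-<-trans (gaps≤ (pos v / b) (pos v % b)) (≤-<-trans (m/n≤m (pos v) b) (pos<M v))

    -- `v` follows `u` on their common chain, so its count has one more term, for a gap at `u`.
    drift-step : ∀ {u v} → pos v ≡ pos u + b → drift v ≡ jump (gap? (pos u)) + drift u
    drift-step {u} {v} eq = begin
      gaps (pos v / b) (pos v % b)
        ≡⟨ cong (λ x → gaps (x / b) (x % b)) eq ⟩
      gaps ((pos u + b) / b) ((pos u + b) % b)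
        ≡⟨ cong₂ gaps ([m+n]/n≡1+m/n (pos u) b) ([m+n]%n≡m%n (pos u) b) ⟩
      jump (gap? (pos u % b + pos u / b * b)) + drift u
        ≡⟨ cong (λ x → jump (gap? x) + drift u) (m≡m%n+[m/n]*n (pos u) b) ⟨
      jump (gap? (pos u)) + drift u ∎
      where open ≡-Reasoning

    value : Vertex → ℕ
    value v = drift v + pos v * M

    shift : ∀ d x → d + (x + b) * M ≡ d + x * M + b * M
    shift d x = trans (cong (d +_) (*-distribʳ-+ M x b)) (sym (+-assoc d (x * M) (b * M)))

    -- At rank distance exactly `b` an edge is no gap and the drifts agree; below that, the slack of
    -- at least `M` absorbs the drift of `v`.
    value-close : ∀ {u v} → Adj u v → value v ≤ value u + b * M
    value-close {u} {v} u~v with <-cmp (pos v) (pos u + b)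
    ... | tri> _ _ gt = contradiction (pos-close u~v) (<⇒≱ gt)
    ... | tri< lt _ _ = begin
        drift v + pos v * M              ≤⟨ +-monoˡ-≤ (pos v * M) (<⇒≤ (drift<M v)) ⟩
        suc (pos v) * M                  ≤⟨ *-monoˡ-≤ M lt ⟩
        (pos u + b) * M                  ≤⟨ m≤n+m ((pos u + b) * M) (drift u) ⟩
        drift u + (pos u + b) * M        ≡⟨ shift (drift u) (pos u) ⟩
        value u + b * M                  ∎
      where open ≤-Reasoning
    ... | tri≈ _ eq _ = ≤-reflexive (trans
        (cong₂ (λ d x → d + x * M) (trans (drift-step {u} {v} eq) (cong (_+ drift u) no-jump)) eq)
        (shift (drift u) (pos u)))
      where
      no-jump : jump (gap? (pos u)) ≡ 0
      no-jump with gap? (pos u)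
      ... | no _ = refl
      ... | yes (w , z , pw , pz , w≁z) = contradiction
        (subst₂ Adj (pos-injective (sym pw)) (pos-injective (trans eq (sym pz))) u~v) w≁z

    -- At rank distance exactly `b` the pair is itself a gap and raises the drift by 1; beyond that,
    -- the extra `M` exceeds the drift of `u`.
    value-far : ∀ {u v} → ¬ Adj u v → pos u + b ≤ pos v → value u + b * M < value v
    value-far {u} {v} u≁v le with m≤n⇒m<n∨m≡n le
    ... | inj₁ lt = begin-strict
        value u + b * M                  ≡⟨ shift (drift u) (pos u) ⟨
        drift u + (pos u + b) * M        <⟨ +-monoˡ-< ((pos u + b) * M) (drift<M u) ⟩
        suc (pos u + b) * M              ≤⟨ *-monoˡ-≤ M lt ⟩
        pos v * M                        ≤⟨ m≤n+m (pos v * M) (drift v) ⟩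
        value v                          ∎
      where open ≤-Reasoning
    ... | inj₂ eq = ≤-reflexive (trans (cong suc (sym (shift (drift u) (pos u))))
        (sym (cong₂ (λ d x → d + x * M) (trans (drift-step {u} {v} (sym eq)) (cong (_+ drift u) one-jump)) (sym eq))))
      where
      one-jump : jump (gap? (pos u)) ≡ 1
      one-jump with gap? (pos u)
      ... | yes _ = refl
      ... | no ¬g = contradiction (u , v , refl , sym eq , u≁v) ¬g

  bandwidth⇒cubes : (pos : Vertex → ℕ) →
    (∀ {u v} → pos u ≡ pos v → u ≡ v) →
    (∀ {u v} → Adj u v → pos v ≤ pos u + b) →
    (M : ℕ) → (∀ v → pos v < suc M) →
    CubeRepresentable G (suc b)
  bandwidth⇒cubes pos pos-injective pos-close M pos<M =
    thresholds⇒cubes G (suc b) threshold coordinate close far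
    where
    module Chain = ChainCoordinate pos pos-injective pos-close (suc M) pos<M

    module Class (i : Fin b) = ClassCoordinate
      -- The shift turns the ranks congruent to `i` modulo `b` into multiples of `b`, making these
      -- vertices the heads.
      (λ v → pos v + (b ∸ toℕ i))
      (λ eq → pos-injective (+-cancelʳ-≡ (b ∸ toℕ i) _ _ eq))
      (λ {u} {v} u~v → subst (pos v + (b ∸ toℕ i) ≤_)
        (xy∙z≈xz∙y +-commutativeSemigroup (pos u) b (b ∸ toℕ i)) (+-monoˡ-≤ (b ∸ toℕ i) (pos-close u~v)))

    threshold : Fin (suc b) → ℕ
    -- Its successor is `b * suc M` by computation.
    threshold zero    = M + b′ * suc M
    threshold (suc _) = 1

    coordinate : Fin (suc b) → Vertex → ℕ
    coordinate zero    = Chain.value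
    coordinate (suc i) = Class.value i

    close : ∀ i {u v} → Adj u v → coordinate i v ≤ coordinate i u + suc (threshold i)
    close zero    = Chain.value-close
    close (suc i) = Class.value-close i

    far-< : ∀ {u v} → pos u < pos v → ¬ Adj u v →
            ∃ λ i → coordinate i u + suc (threshold i) < coordinate i v
    far-< {u} {v} u<v u≁v with pos u + b ≤? pos v
    ... | yes le = zero , Chain.value-far u≁v le
    -- The separating coordinate is that of the residue class of `u`, where `u` is a head.
    ... | no ¬le = suc i , Class.value-far i head u≁v (+-monoˡ-< (b ∸ toℕ i) u<v)
        (subst (pos v + (b ∸ toℕ i) <_) (xy∙z≈xz∙y +-commutativeSemigroup (pos u) b (b ∸ toℕ i)) (+-monoˡ-< (b ∸ toℕ i) (≰⇒> ¬le)))
      where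
      i = pos u mod b
      shifted : pos u + (b ∸ toℕ i) ≡ pos u / b * b + b
      shifted rewrite toℕ-fromℕ< (m%n<n (pos u) b) = begin
        pos u + (b ∸ pos u % b)
          ≡⟨ cong (_+ (b ∸ pos u % b)) (m≡m%n+[m/n]*n (pos u) b) ⟩
        pos u % b + pos u / b * b + (b ∸ pos u % b)
          ≡⟨ xy∙z≈y∙xz +-commutativeSemigroup (pos u % b) (pos u / b * b) (b ∸ pos u % b) ⟩
        pos u / b * b + (pos u % b + (b ∸ pos u % b))
          ≡⟨ cong (pos u / b * b +_) (m+[n∸m]≡n (m%n≤n (pos u) b)) ⟩
        pos u / b * b + b ∎
        where open ≡-Reasoning
      head : Class.IsHead i u
      head = trans (cong (_% b) shifted) (trans ([m+n]%n≡m%n (pos u / b * b) b) (m*n%n≡0 (pos u / b) b))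

    far : ∀ {u v} → u ≢ v → ¬ Adj u v →
          ∃ λ i → coordinate i u + suc (threshold i) < coordinate i v
                ⊎ coordinate i v + suc (threshold i) < coordinate i u
    far {u} {v} u≢v u≁v with <-cmp (pos u) (pos v)
    ... | tri< lt _ _ = map₂ inj₁ (far-< lt u≁v)
    ... | tri≈ _ eq _ = contradiction (pos-injective eq) u≢v
    ... | tri> _ _ gt = map₂ inj₂ (far-< gt (u≁v ∘ Adj-sym))

-- Counting and extremal elements in finite sets

length-mono-⊆ : ∀ {A : Set} {xs ys : List A} → Unique xs → xs ⊆ ys → length xs ≤ length ys
length-mono-⊆ [] _ = z≤n
length-mono-⊆ {xs = x ∷ xs} (x∉xs ∷ uniq) sub
  with as , bs , refl ← ∈-∃++ (sub (here refl)) = begin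
    suc (length xs)                ≤⟨ s≤s (length-mono-⊆ uniq avoid) ⟩
    suc (length (as ++ bs))        ≡⟨ cong suc (length-++ as) ⟩
    suc (length as + length bs)    ≡⟨ +-suc (length as) (length bs) ⟨
    length as + suc (length bs)    ≡⟨ length-++ as ⟨
    length (as ++ x ∷ bs)          ∎
  where
  open ≤-Reasoning
  avoid : xs ⊆ as ++ bs
  avoid {z} z∈xs with ∈-++⁻ as (sub (there z∈xs))
  ... | inj₁ z∈as         = ∈-++⁺ˡ z∈as
  ... | inj₂ (here z≡x)   = contradiction (sym z≡x) (All.lookup x∉xs z∈xs)
  ... | inj₂ (there z∈bs) = ∈-++⁺ʳ as z∈bs

length-strictMono-⊆ : ∀ {A : Set} {xs ys : List A} {y} →
  Unique xs → xs ⊆ ys → y ∈ ys → y ∉ xs → length xs < length ys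
length-strictMono-⊆ {xs = xs} {y = y} uniq sub y∈ys y∉xs =
  length-mono-⊆ (All.tabulate (λ z∈xs y≡z → y∉xs (subst (_∈ xs) (sym y≡z) z∈xs)) ∷ uniq)
    λ where (here refl) → y∈ys
            (there z∈)  → sub z∈

module _ {n : ℕ} where

  members : ∀ {P : Pred (Fin n) 0ℓ} → Decidable P → List (Fin n)
  members P? = filter P? (allFin n)

  module _ {P : Pred (Fin n) 0ℓ} (P? : Decidable P) where

    members-unique : Unique (members P?)
    members-unique = Unique.filter⁺ P? (Unique.allFin⁺ n)

    ∈-members⁺ : ∀ {v} → P v → v ∈ members P?
    ∈-members⁺ = ∈-filter⁺ P? (∈-allFin _)

    ∈-members⁻ : ∀ {v} → v ∈ members P? → P v
    ∈-members⁻ = proj₂ ∘ ∈-filter⁻ P? {xs = allFin n}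

    count : ℕ
    count = length (members P?)

    abstract
      argmin-exists : (m : Fin n → ℕ) → ∃ P → ∃ λ v → P v × (∀ {w} → P w → m v ≤ m w)
      argmin-exists m (v , pv) = argmin m v (members P?)
        , argmin-all m pv (All.all-filter P? (allFin n))
        , λ pw → All.lookup (f[argmin]≤f[xs] v (members P?)) (∈-members⁺ pw)

      argmax-exists : (m : Fin n → ℕ) → ∃ P → ∃ λ v → P v × (∀ {w} → P w → m w ≤ m v)
      argmax-exists m (v , pv) = argmax m v (members P?)
        , argmax-all m pv (All.all-filter P? (allFin n))
        , λ pw → All.lookup (f[xs]≤f[argmax] v (members P?)) (∈-members⁺ pw)

  count-mono : ∀ {P Q : Pred (Fin n) 0ℓ} (P? : Decidable P) (Q? : Decidable Q) →
               (∀ {v} → P v → Q v) → count P? ≤ count Q?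
  count-mono P? Q? P⇒Q =
    length-mono-⊆ (members-unique P?) (∈-members⁺ Q? ∘ P⇒Q ∘ ∈-members⁻ P?)

  count-strictMono : ∀ {P Q : Pred (Fin n) 0ℓ} (P? : Decidable P) (Q? : Decidable Q) →
                     (∀ {v} → P v → Q v) → ∀ {w} → Q w → ¬ P w → count P? < count Q?
  count-strictMono P? Q? P⇒Q qw ¬pw =
    length-strictMono-⊆ (members-unique P?) (∈-members⁺ Q? ∘ P⇒Q ∘ ∈-members⁻ P?)
      (∈-members⁺ Q? qw) (¬pw ∘ ∈-members⁻ P?)

-- Walks and asteroidal triples

module Walks (G : Graph) where
  open Graph G public using (Vertex; Adj; adj?; Adj-sym; Adj-irrefl; order)

  infixr 5 _∷⟨_⟩_
  data Walk (P : Pred Vertex 0ℓ) : Vertex → Vertex → Set where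
    stop    : ∀ {u} → P u → Walk P u u
    _∷⟨_⟩_ : ∀ {u v w} → P u → Adj u v → Walk P v w → Walk P u w

  module _ {P : Pred Vertex 0ℓ} where

    walk-last : ∀ {u v} → Walk P u v → P v
    walk-last (stop p)       = p
    walk-last (_ ∷⟨ _ ⟩ ws) = walk-last ws

    infixl 5 _▷⟨_⟩_
    _▷⟨_⟩_ : ∀ {u v w} → Walk P u v → Adj v w → P w → Walk P u w
    stop p         ▷⟨ e ⟩ q = p ∷⟨ e ⟩ stop q
    (p ∷⟨ f ⟩ ws) ▷⟨ e ⟩ q = p ∷⟨ f ⟩ (ws ▷⟨ e ⟩ q)

    walk-trans : ∀ {u v w} → Walk P u v → Walk P v w → Walk P u w
    walk-trans (stop _)       zs = zs
    walk-trans (p ∷⟨ e ⟩ ws) zs = p ∷⟨ e ⟩ walk-trans ws zs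

    walk-sym : ∀ {u v} → Walk P u v → Walk P v u
    walk-sym (stop p)       = stop p
    walk-sym (p ∷⟨ e ⟩ ws) = walk-sym ws ▷⟨ Adj-sym e ⟩ p

    record SimplePath (u v : Vertex) : Set where
      field
        tail   : List Vertex
        ends   : last (u ∷ tail) ≡ just v
        linked : Linked Adj (u ∷ tail)
        unique : Unique (u ∷ tail)
        all    : All P (u ∷ tail)

    open SimplePath

    suffix : ∀ {u v w} (p : SimplePath w v) → u ∈ w ∷ tail p → SimplePath u v
    suffix p (here refl) = p
    suffix record { tail = _ ∷ xs ; ends = e ; linked = _ ∷ l ; unique = _ ∷ d ; all = _ ∷ a } (there u∈) =
      suffix record { tail = xs ; ends = e ; linked = l ; unique = d ; all = a } u∈

    -- Loops are cut out as they close: if `u` recurs on the path already built, only the part from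
    -- that occurrence on is kept.
    walk⇒path : ∀ {u v} → Walk P u v → SimplePath u v
    walk⇒path (stop p) = record
      { tail = [] ; ends = refl ; linked = [-] ; unique = [] ∷ [] ; all = p ∷ [] }
    walk⇒path {u} (_∷⟨_⟩_ {v = w} p e ws) with walk⇒path ws
    ... | path with _∈?_ _≟_ u (w ∷ tail path)
    ... | yes u∈ = suffix path u∈
    ... | no  u∉ = record
      { tail   = w ∷ tail path
      ; ends   = ends path
      ; linked = e ∷ linked path
      ; unique = All.¬Any⇒All¬ _ u∉ ∷ unique path
      ; all    = p ∷ all path
      }

  Away : Vertex → Pred Vertex 0ℓ
  Away w v = v ≢ w × ¬ Adj v w

  away? : ∀ w → Decidable (Away w)
  away? w v = ¬? (v ≟ w) ×-dec ¬? (adj? v w)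

  Away-sym : ∀ {u v} → Away u v → Away v u
  Away-sym (v≢u , v≁u) = v≢u ∘ sym , v≁u ∘ Adj-sym

  avoiding-path : ∀ {u v w} → Walk (Away w) u v → PathAvoidingNbhd G u v w
  avoiding-path {u} ws = record
    { vertices = u ∷ tail ; starts = refl ; ends = ends ; linked = linked ; unique = unique } , all
    where open SimplePath (walk⇒path ws)

  -- Distinctness and non-adjacency need no separate hypotheses: the end vertices of each walk are
  -- themselves away from the third vertex.
  no-asteroidal-walks : ATFree G → ∀ {x y z} →
    Walk (Away z) x y → Walk (Away x) y z → Walk (Away y) x z → ⊥
  no-asteroidal-walks at-free {x} {y} {z} xy yz xz = at-free x y z record
    { x≢y = proj₁ x-away-y ; y≢z = proj₁ y-away-z ; x≢z = proj₁ x-away-z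
    ; ¬x~y = proj₂ x-away-y ; ¬y~z = proj₂ y-away-z ; ¬x~z = proj₂ x-away-z
    ; xy = avoiding-path xy ; yz = avoiding-path yz ; xz = avoiding-path xz }
    where
    x-away-y : Away y x
    x-away-y = walk-last (walk-sym xz)
    y-away-z : Away z y
    y-away-z = walk-last xy
    x-away-z : Away z x
    x-away-z = Away-sym (walk-last yz)

-- Reachability and distance levels

least : ∀ {P : ℕ → Set} → Decidable P → ∀ {k} → P k → ∃ λ m → P m × (∀ {j} → P j → m ≤ j)
least P? {zero} p = 0 , p , λ _ → z≤n
least P? {suc k} p with P? 0
... | yes p₀ = 0 , p₀ , λ _ → z≤n
... | no ¬p₀ with m , pm , min ← least (P? ∘ suc) p =
  suc m , pm , λ { {zero} p₀ → contradiction p₀ ¬p₀ ; {suc j} pj → s≤s (min pj) }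

module Connectivity (G : Graph) where
  open Walks G public

  Reach : Vertex → Vertex → Set
  Reach = Walk U

  forget : ∀ {P u v} → Walk P u v → Reach u v
  forget (stop _)      = stop _
  forget (_ ∷⟨ e ⟩ ws) = _ ∷⟨ e ⟩ forget ws

  Near : Vertex → Vertex → Set
  Near u v = u ≡ v ⊎ Adj u v

  near? : ∀ u v → Dec (Near u v)
  near? u v = (u ≟ v) ⊎-dec adj? u v

  ¬near⇒away : ∀ {u v} → ¬ Near u v → Away v u
  ¬near⇒away ¬near = ¬near ∘ inj₁ , ¬near ∘ inj₂

  module Distance (reach? : ∀ u v → Dec (Reach u v)) (x : Vertex) where

    Ball : ℕ → Vertex → Set
    Ball zero    v = v ≡ x
    Ball (suc k) v = Ball k v ⊎ ∃ λ u → Adj v u × Ball k u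

    ball? : ∀ k v → Dec (Ball k v)
    ball? zero    v = v ≟ x
    ball? (suc k) v = ball? k v ⊎-dec any? λ u → adj? v u ×-dec ball? k u

    walk⇒ball : ∀ {v} → Reach v x → ∃ λ k → Ball k v
    walk⇒ball (stop _)      = 0 , refl
    walk⇒ball (_ ∷⟨ e ⟩ ws) = let k , b = walk⇒ball ws in suc k , inj₂ (_ , e , b)

    abstract
      radius : ∀ v → ∃ λ k → (Reach x v → Ball k v) × (∀ {j} → Ball j v → k ≤ j)
      radius v with reach? x v
      ... | no ¬r = 0 , (λ r → contradiction r ¬r) , λ _ → z≤n
      ... | yes r with k , b , min ← least (λ k → ball? k v) (proj₂ (walk⇒ball (walk-sym r))) =
        k , (λ _ → b) , min

    -- Distance from x, with the junk value 0 outside the component of x.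
    ℓ : Vertex → ℕ
    ℓ v = proj₁ (radius v)

    private
      ball-ℓ : ∀ {v} → Reach x v → Ball (ℓ v) v
      ball-ℓ {v} = proj₁ (proj₂ (radius v))

      ℓ-least : ∀ {v j} → Ball j v → ℓ v ≤ j
      ℓ-least {v} = proj₂ (proj₂ (radius v))

    ℓ-root : ℓ x ≡ 0
    ℓ-root = n≤0⇒n≡0 (ℓ-least {x} {0} refl)

    ℓ≡0⇒root : ∀ {v} → Reach x v → ℓ v ≡ 0 → v ≡ x
    ℓ≡0⇒root {v} r eq = subst (λ k → Ball k v) eq (ball-ℓ r)

    ℓ-step : ∀ {u v} → Reach x u → Adj u v → ℓ v ≤ suc (ℓ u)
    ℓ-step {u} r e = ℓ-least {j = suc (ℓ u)} (inj₂ (u , Adj-sym e , ball-ℓ r))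

    Lower : Vertex → Vertex → Set
    Lower v u = Adj v u × suc (ℓ u) ≡ ℓ v

    lower? : ∀ v u → Dec (Lower v u)
    lower? v u = adj? v u ×-dec (suc (ℓ u) ℕ.≟ ℓ v)

    lower-exists : ∀ {v k} → Reach x v → ℓ v ≡ suc k → ∃ (Lower v)
    lower-exists {v} {k} r eq with subst (λ k → Ball k v) eq (ball-ℓ r)
    ... | inj₁ b = contradiction (subst (_≤ k) eq (ℓ-least b)) (<⇒≱ ≤-refl)
    ... | inj₂ (u , e , b) = u , e , ≤-antisym (subst (suc (ℓ u) ≤_) (sym eq) (s≤s (ℓ-least b)))
                                              (ℓ-step (r ▷⟨ e ⟩ _) (Adj-sym e))

    ℓ≡1⇒adjacent : ∀ {v} → Reach x v → ℓ v ≡ 1 → Adj v x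
    ℓ≡1⇒adjacent {v} r eq with u , e , eq′ ← lower-exists r eq =
      subst (Adj v) (ℓ≡0⇒root (r ▷⟨ e ⟩ _) (suc-injective (trans eq′ eq))) e

    away⇒2≤ℓ : ∀ {v} → Reach x v → Away x v → 2 ≤ ℓ v
    away⇒2≤ℓ {v} r (v≢x , v≁x) with ℓ v in eq
    ... | 0           = contradiction (ℓ≡0⇒root r eq) v≢x
    ... | 1           = contradiction (ℓ≡1⇒adjacent r eq) v≁x
    ... | suc (suc _) = s≤s (s≤s z≤n)

    2≤ℓ⇒away : ∀ {v} → 2 ≤ ℓ v → Away x v
    2≤ℓ⇒away {v} le = (λ { refl → <⇒≱ (s≤s (z≤n {1})) (subst (2 ≤_) ℓ-root le) })
      , λ e → <⇒≱ (s≤s (subst (λ k → suc k ≤ 1) (sym ℓ-root) ≤-refl)) (≤-trans le (ℓ-step (stop _) (Adj-sym e)))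

    -- On a shortest walk from `x` to `a`, all vertices before `a` are at least two levels below
    -- `v`, hence away from it.
    descend : ∀ k {a v} → ℓ a ≡ k → Reach x a → k < ℓ v → Away v a → Walk (Away v) x a
    descend zero    {a} {v} eq r lt away =
      subst (λ b → Walk (Away v) b a) (ℓ≡0⇒root r eq) (stop away)
    descend (suc k) {a} {v} eq r lt away with u , e , eq′ ← lower-exists r eq =
      descend k ℓu≡k ru (<-trans (n<1+n k) lt) u-away ▷⟨ Adj-sym e ⟩ away
      where
      ru : Reach x u
      ru = r ▷⟨ e ⟩ _
      ℓu≡k : ℓ u ≡ k
      ℓu≡k = suc-injective (trans eq′ eq)
      u-away : Away v u
      u-away = (λ { refl → <⇒≱ (<-trans (n<1+n k) lt) (≤-reflexive ℓu≡k) })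
             , λ u~v → <⇒≱ lt (subst (λ j → ℓ v ≤ suc j) ℓu≡k (ℓ-step ru u~v))

-- Walks that dominate a component

module Spines (G : Graph)
  (reach? : ∀ u v → Dec (Walks.Walk G U u v))
  (walk-away? : ∀ x u v → Dec (Walks.Walk G (Walks.Away G x) u v))
  where
  open Connectivity G public

  -- The walk is infinite: past the ends of a path it turns back.
  record Spine (r : Vertex) : Set where
    field
      at      : ℕ → Vertex
      foot    : Vertex → ℕ
      covers  : ∀ {v} → Reach r v → Near v (at (foot v))
      close   : ∀ {u v} → Reach r u → Adj u v → foot v ≤ 2 + foot u
      at-walk : ∀ {u v} → Reach r u → Adj u v → ∀ j → Adj (at j) (at (suc j))

  step : Vertex → Vertex
  step v with any? (adj? v)
  ... | yes (w , _) = w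
  ... | no _        = v

  step-adj : ∀ {v w} → Adj v w → Adj v (step v)
  step-adj {v} {w} e with any? (adj? v)
  ... | yes (_ , f) = f
  ... | no none     = contradiction (w , e) none

  -- All feet are 0, so after `r` the walk may follow arbitrary edges.
  star-spine : ∀ r → (∀ {v} → Reach r v → Near v r) → Spine r
  star-spine r near = record
    { at = at ; foot = λ _ → 0 ; covers = near ; close = λ _ _ → z≤n
    ; at-walk = λ ru uv j → proj₂ (at-walk (r-neighbour ru uv) j) }
    where
    at : ℕ → Vertex
    at zero    = r
    at (suc j) = step (at j)

    r-neighbour : ∀ {u v} → Reach r u → Adj u v → ∃ (Adj r)
    r-neighbour (stop _)      uv = _ , uv
    r-neighbour (_ ∷⟨ e ⟩ _) _  = _ , e

    at-walk : ∃ (Adj r) → ∀ j → ∃ (Adj (at j)) × Adj (at j) (at (suc j))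
    at-walk n@(_ , e) zero = n , step-adj e
    at-walk n (suc j) = (at j , back) , step-adj back
      where
      back : Adj (at (suc j)) (at j)
      back = Adj-sym (proj₂ (at-walk n j))

  module FarSpine (at-free : ATFree G) {x r : Vertex} (x⇝r : Reach x r) (r-away : Away x r)
    where
    open Distance reach? x

    -- `C w` is the component of `r` in the graph without the closed neighbourhood of `w`.
    C : Vertex → Vertex → Set
    C w = Walk (Away w) r

    module _ (maximal : ∀ {w} → Reach x w → Away w r →
                        count (walk-away? w r) ≤ count (walk-away? x r)) where

      C⇒reach : ∀ {v} → C x v → Reach x v
      C⇒reach = walk-trans x⇝r ∘ forget

      -- Otherwise a ∈ N(C) joins C inside G - N[w], contradicting maximality.
      outside-complete : ∀ {w c a} → Reach x w → ¬ C x w → (∀ {c} → C x c → ¬ Adj c w) →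
                         C x c → Adj c a → ¬ C x a → Adj a w
      outside-complete {w} {c} {a} x⇝w w∉C w∉NC c∈C c~a a∉C = decidable-stable (adj? a w) λ a≁w →
        <⇒≱ (count-strictMono (walk-away? x r) (walk-away? w r) (lift (stop r-away))
               (lift (stop r-away) c∈C ▷⟨ c~a ⟩ ((λ { refl → w∉NC c∈C c~a }) , a≁w)) a∉C)
            (maximal x⇝w (C⊆away (stop r-away)))
        where
        C⊆away : ∀ {v} → C x v → Away w v
        C⊆away v∈C = (λ { refl → w∉C v∈C }) , w∉NC v∈C

        lift : ∀ {u v} → C x u → Walk (Away x) u v → Walk (Away w) u v
        lift u∈C (stop _)       = stop (C⊆away u∈C)
        lift u∈C (_ ∷⟨ e ⟩ ws) = C⊆away u∈C ∷⟨ e ⟩ lift (u∈C ▷⟨ e ⟩ walk-last (walk-sym ws)) ws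

      -- One leg of an asteroidal triple {x, u, v}.
      arm : ∀ {u v a} → Reach x u → ℓ u ≡ ℓ v → Away v u → Lower u a → ¬ Lower v a →
            Walk (Away v) x u
      arm {u} {v} {a} x⇝u ℓu≡ℓv away (u~a , ℓa) ¬low =
        descend (ℓ a) refl (x⇝u ▷⟨ u~a ⟩ _) a<v
          ((λ { refl → <-irrefl refl a<v }) , λ a~v → ¬low (Adj-sym a~v , trans ℓa ℓu≡ℓv))
          ▷⟨ Adj-sym u~a ⟩ away
        where
        a<v : ℓ a < ℓ v
        a<v = ≤-reflexive (trans ℓa ℓu≡ℓv)

      -- Each of `u`, `v` is joined to `x` through its private lower neighbour, and they are joined
      -- to each other inside `C x`, so `x`, `u`, `v` would form an asteroidal triple.
      no-crossing : ∀ {u v a b} → C x u → C x v → ℓ u ≡ ℓ v → Away v u →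
                    Lower u a → ¬ Lower v a → Lower v b → ¬ Lower u b → ⊥
      no-crossing u∈C v∈C eq away ua ¬va vb ¬ub = no-asteroidal-walks at-free
        (arm (C⇒reach u∈C) eq away ua ¬va)
        (walk-trans (walk-sym u∈C) v∈C)
        (arm (C⇒reach v∈C) (sym eq) (Away-sym away) vb ¬ub)

      down-degree : Vertex → ℕ
      down-degree v = count (lower? v)

      -- By `no-crossing` the two sets of lower neighbours are nested, and their sizes decide the
      -- direction.
      lower-⊆ : ∀ {s z a} → C x s → C x z → ℓ s ≡ ℓ z → Away s z →
                down-degree s ≤ down-degree z → Lower s a → Lower z a
      lower-⊆ {s} {z} {a} s∈C z∈C eq away le sa = decidable-stable (lower? z a) λ ¬za →
        <⇒≱ (count-strictMono (lower? z) (lower? s)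
              (λ {b} zb → decidable-stable (lower? s b) λ ¬sb →
                no-crossing s∈C z∈C eq (Away-sym away) sa ¬za zb ¬sb)
              sa ¬za)
            le

      -- Otherwise {x, z, s′} would be an asteroidal triple.
      lower-⊆-outside : ∀ {s s′ z a} → C x s′ → C x z → Lower s′ s → ℓ s ≡ ℓ z → Away s z →
                        ¬ Lower s′ z → Lower s a → Lower z a
      lower-⊆-outside {s} {s′} {z} {a} s′∈C z∈C (s′~s , ℓs) eq away ¬s′z sa =
        decidable-stable (lower? z a) λ ¬za → no-asteroidal-walks at-free
          (arm (C⇒reach s′∈C ▷⟨ s′~s ⟩ _) eq (Away-sym away) sa ¬za ▷⟨ Adj-sym s′~s ⟩ Away-sym z-away)
          (walk-trans (walk-sym s′∈C) z∈C)
          (descend (ℓ z) refl (C⇒reach z∈C) z<s′ z-away)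
        where
        z<s′ : ℓ z < ℓ s′
        z<s′ = ≤-reflexive (trans (cong suc (sym eq)) ℓs)
        z-away : Away s′ z
        z-away = (λ { refl → <-irrefl refl z<s′ })
               , λ z~s′ → ¬s′z (Adj-sym z~s′ , ≤-antisym z<s′ (ℓ-step (C⇒reach z∈C) z~s′))

      top : ∃ λ v → C x v × (∀ {w} → C x w → ℓ w ≤ ℓ v)
      top = argmax-exists (walk-away? x r) ℓ (r , stop r-away)

      d : ℕ
      d = ℓ (proj₁ top)

      -- Minimality within the top level of `C x` lets `lower-⊆` apply to the start of the walk.
      apex-exists : ∃ λ v → (C x v × ℓ v ≡ d) × (∀ {w} → C x w × ℓ w ≡ d → down-degree v ≤ down-degree w)
      apex-exists = argmin-exists (λ v → walk-away? x r v ×-dec (ℓ v ℕ.≟ d)) down-degree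
        (proj₁ top , proj₁ (proj₂ top) , refl)

      -- At `x`, which has no lower neighbour, the walk bounces off along an arbitrary edge.
      next : Vertex → Vertex
      next v with any? (lower? v)
      ... | yes some = proj₁ (argmin-exists (lower? v) down-degree some)
      ... | no _     = step v

      next-lower : ∀ {v} → ∃ (Lower v) → Lower v (next v)
      next-lower {v} some with any? (lower? v)
      ... | yes some′ = proj₁ (proj₂ (argmin-exists (lower? v) down-degree some′))
      ... | no none   = contradiction some none

      next-min : ∀ {v w} → Lower v w → down-degree (next v) ≤ down-degree w
      next-min {v} {w} low with any? (lower? v)
      ... | yes some = proj₂ (proj₂ (argmin-exists (lower? v) down-degree some)) low
      ... | no none  = contradiction (w , low) none

      next-adj : ∀ {v w} → Adj v w → Adj v (next v)
      next-adj {v} e with any? (lower? v)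
      ... | yes some = proj₁ (proj₁ (proj₂ (argmin-exists (lower? v) down-degree some)))
      ... | no _     = step-adj e

      at : ℕ → Vertex
      at zero    = proj₁ apex-exists
      at (suc j) = next (at j)

      -- Writing the level as an `i` with `i + j ≡ d` avoids subtraction in this joint induction on
      -- `j`.
      at-level : ∀ i j → i + j ≡ d → Reach x (at j) × ℓ (at j) ≡ i
      at-lower : ∀ i j → suc i + j ≡ d → Lower (at j) (at (suc j))

      at-level i zero eq =
        let (apex∈C , ℓ-apex) , _ = proj₂ apex-exists
        in C⇒reach apex∈C , trans ℓ-apex (trans (sym eq) (+-identityʳ i))
      at-level i (suc j) eq =
        let eq′ = trans (sym (+-suc i j)) eq
            reach , level = at-level (suc i) j eq′
            e , low = at-lower i j eq′
        in reach ▷⟨ e ⟩ _ , suc-injective (trans low level)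

      at-lower i j eq =
        let reach , level = at-level (suc i) j eq
        in next-lower (lower-exists reach level)

      -- Levels from 2 upwards are away from `x`, so the descent stays in the component until level
      -- 1.
      at∈C : ∀ i j → 2 + i + j ≡ d → C x (at j)
      at∈C i zero    eq = proj₁ (proj₁ (proj₂ apex-exists))
      at∈C i (suc j) eq =
        let eq′ = trans (sym (+-suc (2 + i) j)) eq
        in at∈C (suc i) j eq′ ▷⟨ proj₁ (at-lower (2 + i) j eq′) ⟩
           2≤ℓ⇒away (≤-trans (s≤s (s≤s z≤n)) (≤-reflexive (sym (proj₂ (at-level (2 + i) (suc j) eq)))))

      -- At the start this is minimality in the top level. Later, either `z` competed with
      -- `at (suc j)` among the lower neighbours of `at j`, or `at j` serves as the `s′` of
      -- `lower-⊆-outside`.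
      lower-at-⊆ : ∀ i j → 2 + i + j ≡ d → ∀ {z a} → C x z → ℓ z ≡ 2 + i → Away (at j) z →
                   Lower (at j) a → Lower z a
      lower-at-⊆ i zero eq z∈C ℓz away =
        let (apex∈C , ℓ-apex) , min = proj₂ apex-exists
            ℓz≡d = trans ℓz (trans (sym (+-identityʳ (2 + i))) eq)
        in lower-⊆ apex∈C z∈C (trans ℓ-apex (sym ℓz≡d)) away (min (z∈C , ℓz≡d))
      lower-at-⊆ i (suc j) eq {z} z∈C ℓz away
        with eq′ ← trans (sym (+-suc (2 + i) j)) eq
        with lower? (at j) z | trans (proj₂ (at-level (2 + i) (suc j) eq)) (sym ℓz)
      ... | yes low | same = lower-⊆ (at∈C i (suc j) eq) z∈C same away (next-min low)
      ... | no ¬low | same =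
        lower-⊆-outside (at∈C (suc i) j eq′) z∈C (at-lower (2 + i) j eq′) same away ¬low

      2≤d : 2 ≤ d
      2≤d = ≤-trans (away⇒2≤ℓ x⇝r r-away) (proj₂ (proj₂ top) (stop r-away))

      at-d : at d ≡ x
      at-d = let reach , level = at-level 0 d refl in ℓ≡0⇒root reach level

      covered : ∀ {v} → Reach x v → Away (at (d ∸ ℓ v)) v → Adj v (at (suc (d ∸ ℓ v)))
      covered {v} x⇝v away with ℓ v in ℓv
      ... | 0 = contradiction (trans (ℓ≡0⇒root x⇝v ℓv) (sym at-d)) (proj₁ away)
      ... | 1 = subst (Adj v) (sym (trans (cong at (m+[n∸m]≡n (≤-trans (n≤1+n 1) 2≤d))) at-d))
                  (ℓ≡1⇒adjacent x⇝v ℓv)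
      ... | suc (suc i) with walk-away? x r v
      -- The next vertex of the walk is a lower neighbour of `at j`, hence also of `v`.
      ...   | yes v∈C = proj₁ (lower-at-⊆ i j eq v∈C ℓv away (at-lower (suc i) j eq))
        where
        j = d ∸ (2 + i)
        eq : 2 + i + j ≡ d
        eq = m+[n∸m]≡n (subst (_≤ d) ℓv (proj₂ (proj₂ top) v∈C))
      -- Being away from `x` and outside `C x`, `v` has no neighbour in `C x`. So `outside-complete`
      -- joins it to the walk's vertex on level 1, and `v` must have level 2.
      ...   | no v∉C = subst (λ k → Adj v (at (suc (d ∸ (2 + k))))) (sym i≡0) v~a
        where
        j = d ∸ 2
        eq : 2 + j ≡ d
        eq = m+[n∸m]≡n 2≤d
        a-level : Reach x (at (suc j)) × ℓ (at (suc j)) ≡ 1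
        a-level = at-level 1 (suc j) eq
        v-away : Away x v
        v-away = 2≤ℓ⇒away (≤-trans (s≤s (s≤s z≤n)) (≤-reflexive (sym ℓv)))
        a∉C : ¬ C x (at (suc j))
        a∉C a∈C = proj₂ (walk-last a∈C) (ℓ≡1⇒adjacent (proj₁ a-level) (proj₂ a-level))
        v~a : Adj v (at (suc j))
        v~a = Adj-sym (outside-complete x⇝v v∉C (λ c∈C c~v → v∉C (c∈C ▷⟨ c~v ⟩ v-away))
          (at∈C 0 j eq) (proj₁ (at-lower 1 j eq)) a∉C)
        i≡0 : i ≡ 0
        i≡0 = n≤0⇒n≡0 (s≤s⁻¹ (s≤s⁻¹ (subst₂ _≤_ ℓv (cong suc (proj₂ a-level))
                (ℓ-step (proj₁ a-level) (Adj-sym v~a)))))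

      base : Vertex → ℕ
      base v = d ∸ ℓ v

      foot : Vertex → ℕ
      foot v with near? v (at (base v))
      ... | yes _ = base v
      ... | no _  = suc (base v)

      base≤foot : ∀ v → base v ≤ foot v
      base≤foot v with near? v (at (base v))
      ... | yes _ = ≤-refl
      ... | no _  = n≤1+n _

      foot≤1+base : ∀ v → foot v ≤ suc (base v)
      foot≤1+base v with near? v (at (base v))
      ... | yes _ = n≤1+n _
      ... | no _  = ≤-refl

      covers : ∀ {v} → Reach x v → Near v (at (foot v))
      covers {v} x⇝v with near? v (at (base v))
      ... | yes near = near
      ... | no ¬near = inj₂ (covered x⇝v (¬near⇒away ¬near))

      base-close : ∀ {u v} → Reach x v → Adj v u → base v ≤ suc (base u)
      base-close {u} {v} x⇝v v~u = m≤n+o⇒m∸n≤o d (ℓ v) (begin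
        d                        ≤⟨ m≤n+m∸n d (ℓ u) ⟩
        ℓ u + base u             ≤⟨ +-monoˡ-≤ (base u) (ℓ-step x⇝v v~u) ⟩
        suc (ℓ v) + base u       ≡⟨ +-suc (ℓ v) (base u) ⟨
        ℓ v + suc (base u)       ∎)
        where open ≤-Reasoning

      -- `next` follows an edge whenever there is one, and the edge just walked is always available
      -- for turning back.
      at-walk : ∀ j → Adj (at j) (at (suc j))
      at-walk zero    = let k , eq = m≤n⇒∃[o]m+o≡n 2≤d in
        next-adj (proj₁ (at-lower (suc k) 0 (trans (+-identityʳ (2 + k)) eq)))
      at-walk (suc j) = next-adj (Adj-sym (at-walk j))

      far-spine : Spine r
      far-spine = record
        { at = at ; foot = foot
        ; covers = λ r⇝v → covers (walk-trans x⇝r r⇝v)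
        -- One unit comes from the change of level along the edge, the other from the choice of
        -- foot.
        ; close = λ {u} {v} r⇝u u~v → ≤-trans (foot≤1+base v) (s≤s (≤-trans
            (base-close (walk-trans x⇝r r⇝u ▷⟨ u~v ⟩ _) (Adj-sym u~v)) (s≤s (base≤foot u))))
        ; at-walk = λ _ _ → at-walk
        }

  abstract
    -- Either `r` dominates its component, or some `x` in it is away from `r` and one with the
    -- largest `C x` can be chosen.
    spine : ATFree G → ∀ r → Spine r
    spine at-free r with any? (λ x → reach? x r ×-dec away? x r)
    ... | no none = star-spine r λ {v} r⇝v → decidable-stable (near? v r)
          λ ¬near → none (v , walk-sym r⇝v , Away-sym (¬near⇒away ¬near))
    ... | yes some with x , (x⇝r , away) , max ← argmax-exists (λ x → reach? x r ×-dec away? x r)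
                        (λ x → count (walk-away? x r)) some =
          FarSpine.far-spine at-free x⇝r away
            λ x⇝w w-away → max (walk-trans (walk-sym x⇝w) x⇝r , w-away)

-- Ordering the vertices by their feet

-- `a * K + b` encodes pairs lexicographically; a bounded second component cannot outweigh the
-- first.
*+-cancel-≤ : ∀ K {a b a′ b′} → b′ < K → a * K + b ≤ a′ * K + b′ → a ≤ a′
*+-cancel-≤ K {a} {b} {a′} {b′} b′<K le = ≮⇒≥ λ a′<a → <⇒≱ (begin-strict
  a′ * K + b′    <⟨ +-monoʳ-< (a′ * K) b′<K ⟩
  a′ * K + K     ≡⟨ +-comm (a′ * K) K ⟩
  suc a′ * K     ≤⟨ *-monoˡ-≤ K a′<a ⟩
  a * K          ≤⟨ m≤m+n (a * K) b ⟩
  a * K + b      ∎) le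
  where open ≤-Reasoning

≤2+⇒cases : ∀ {i k} → i ≤ k → k ≤ 2 + i → k ≡ i ⊎ k ≡ 1 + i ⊎ k ≡ 2 + i
≤2+⇒cases {i} i≤k k≤2+i with m≤n⇒∃[o]m+o≡n i≤k
... | 0 , refl = inj₁ (+-identityʳ i)
... | 1 , refl = inj₂ (inj₁ (+-comm i 1))
... | 2 , refl = inj₂ (inj₂ (+-comm i 2))
... | suc (suc (suc j)) , refl = contradiction
  (+-cancelˡ-≤ i (3 + j) 2 (≤-trans k≤2+i (≤-reflexive (+-comm 2 i)))) (λ where (s≤s (s≤s ())))

module RankOrdering (G : Graph)
  (reach? : ∀ u v → Dec (Walks.Walk G U u v))
  (walk-away? : ∀ x u v → Dec (Walks.Walk G (Walks.Away G x) u v))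
  (at-free : ATFree G)
  where
  open Spines G reach? walk-away?

  degree≤Δ : ∀ v → Graph.degree G v ≤ Δ G
  degree≤Δ v = All.lookup (xs≤max 0 (map (Graph.degree G) (allFin order)))
    (∈-map⁺ (Graph.degree G) (∈-allFin v))

  other-neighbour? : ∀ a b → Decidable (λ w → Adj a w × w ≢ b)
  other-neighbour? a b w = adj? a w ×-dec ¬? (w ≟ b)

  -- This lists N[a] ∪ N[b] ∪ N[c] for a walk `a`, `b`, `c`: the ends occur as neighbours of `b`,
  -- and `b` is left out of their lists. So the length is at most 1 + Δ + 2(Δ - 1) = 3Δ - 1.
  path-nbhd : Vertex → Vertex → Vertex → List Vertex
  path-nbhd a b c =
    b ∷ members (adj? b) ++ members (other-neighbour? a b) ++ members (other-neighbour? c b)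

  module _ {a b c : Vertex} (a~b : Adj a b) (b~c : Adj b c) where

    ∈-path-nbhd : ∀ {v} → Near v a ⊎ Near v b ⊎ Near v c → v ∈ path-nbhd a b c
    ∈-path-nbhd (inj₁ (inj₁ refl)) = there (∈-++⁺ˡ (∈-members⁺ (adj? b) (Adj-sym a~b)))
    ∈-path-nbhd {v} (inj₁ (inj₂ v~a)) with v ≟ b
    ... | yes v≡b = here v≡b
    ... | no  v≢b = there (∈-++⁺ʳ (members (adj? b))
          (∈-++⁺ˡ (∈-members⁺ (other-neighbour? a b) (Adj-sym v~a , v≢b))))
    ∈-path-nbhd (inj₂ (inj₁ (inj₁ v≡b))) = here v≡b
    ∈-path-nbhd (inj₂ (inj₁ (inj₂ v~b))) = there (∈-++⁺ˡ (∈-members⁺ (adj? b) (Adj-sym v~b)))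
    ∈-path-nbhd (inj₂ (inj₂ (inj₁ refl))) = there (∈-++⁺ˡ (∈-members⁺ (adj? b) b~c))
    ∈-path-nbhd {v} (inj₂ (inj₂ (inj₂ v~c))) with v ≟ b
    ... | yes v≡b = here v≡b
    ... | no  v≢b = there (∈-++⁺ʳ (members (adj? b)) (∈-++⁺ʳ (members (other-neighbour? a b))
          (∈-members⁺ (other-neighbour? c b) (Adj-sym v~c , v≢b))))

    path-nbhd-size : ∀ {δ} → Δ G ≡ suc δ → length (path-nbhd a b c) ≤ suc (suc δ + (δ + δ))
    path-nbhd-size {δ} Δ≡ = s≤s (begin
      length (members (adj? b) ++ members (other-neighbour? a b) ++ members (other-neighbour? c b))
        ≡⟨ length-++ (members (adj? b)) ⟩
      Graph.degree G b + length (members (other-neighbour? a b) ++ members (other-neighbour? c b))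
        ≡⟨ cong (Graph.degree G b +_) (length-++ (members (other-neighbour? a b))) ⟩
      Graph.degree G b + (count (other-neighbour? a b) + count (other-neighbour? c b))
        ≤⟨ +-mono-≤ (degree≤ b) (+-mono-≤ (others a~b) (others (Adj-sym b~c))) ⟩
      suc δ + (δ + δ) ∎)
      where
      open ≤-Reasoning
      degree≤ : ∀ v → Graph.degree G v ≤ suc δ
      degree≤ v = subst (Graph.degree G v ≤_) Δ≡ (degree≤Δ v)
      others : ∀ {v} → Adj v b → count (other-neighbour? v b) ≤ δ
      others {v} v~b = s≤s⁻¹ (≤-trans
        (count-strictMono (other-neighbour? v b) (adj? v) proj₁ v~b λ (_ , b≢b) → b≢b refl)
        (degree≤ v))

  -- Taking the least index makes the representative depend on the component only.
  root-exists : ∀ v → ∃ λ r → Reach r v × (∀ {w} → Reach w v → toℕ r ≤ toℕ w)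
  root-exists v = argmin-exists (λ w → reach? w v) toℕ (v , stop _)

  root : Vertex → Vertex
  root v = proj₁ (root-exists v)

  root-reaches : ∀ v → Reach (root v) v
  root-reaches v = proj₁ (proj₂ (root-exists v))

  root-adj : ∀ {u v} → Adj u v → root u ≡ root v
  root-adj {u} {v} u~v = toℕ-injective (≤-antisym (root-min (Adj-sym u~v)) (root-min u~v))
    where
    root-min : ∀ {u v} → Adj u v → toℕ (root v) ≤ toℕ (root u)
    root-min {u} {v} u~v = proj₂ (proj₂ (root-exists v)) (root-reaches u ▷⟨ u~v ⟩ _)

  module SpineOf (r : Vertex) = Spine (spine at-free r)

  foot : Vertex → ℕ
  foot v = SpineOf.foot (root v) v

  K : ℕ
  K = suc (max 0 (map foot (allFin order)))

  foot<K : ∀ v → foot v < K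
  foot<K v = s≤s (All.lookup (xs≤max 0 (map foot (allFin order))) (∈-map⁺ foot (∈-allFin v)))

  -- The order is by component, then by foot, with ties broken by index.
  group key : Vertex → ℕ
  group v = toℕ (root v) * K + foot v
  key v = group v * order + toℕ v

  key⇒group : ∀ {u v} → key u ≤ key v → group u ≤ group v
  key⇒group {u} {v} = *+-cancel-≤ order (toℕ<n v)

  key⇒root : ∀ {u v} → key u ≤ key v → toℕ (root u) ≤ toℕ (root v)
  key⇒root {u} {v} = *+-cancel-≤ K (foot<K v) ∘ key⇒group {u} {v}

  key⇒foot : ∀ {u v} → root u ≡ root v → key u ≤ key v → foot u ≤ foot v
  key⇒foot {u} {v} eq le = +-cancelˡ-≤ (toℕ (root v) * K) (foot u) (foot v)
    (subst (λ r → toℕ r * K + foot u ≤ group v) eq (key⇒group {u} {v} le))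

  key-injective : ∀ {u v} → key u ≡ key v → u ≡ v
  key-injective {u} {v} eq = toℕ-injective (+-cancelˡ-≡ (group v * order) (toℕ u) (toℕ v)
    (subst (λ g → g * order + toℕ u ≡ key v) same eq))
    where
    same : group u ≡ group v
    same = ≤-antisym (key⇒group {u} {v} (≤-reflexive eq)) (key⇒group {v} {u} (≤-reflexive (sym eq)))

  before? : ∀ v → Decidable (λ w → key w < key v)
  before? v w = key w <? key v

  rank : Vertex → ℕ
  rank v = count (before? v)

  rank-mono : ∀ {u v} → key u ≤ key v → rank u ≤ rank v
  rank-mono {u} {v} le = count-mono (before? u) (before? v) λ lt → <-≤-trans lt le

  rank-strictMono : ∀ {u v} → key u < key v → rank u < rank v
  rank-strictMono {u} {v} lt =
    count-strictMono (before? u) (before? v) (λ lt′ → <-trans lt′ lt) lt (<-irrefl refl)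

  rank-injective : ∀ {u v} → rank u ≡ rank v → u ≡ v
  rank-injective {u} {v} eq with <-cmp (key u) (key v)
  ... | tri< lt _ _ = contradiction eq (<⇒≢ (rank-strictMono lt))
  ... | tri≈ _ ke _ = key-injective ke
  ... | tri> _ _ gt = contradiction (sym eq) (<⇒≢ (rank-strictMono gt))

  rank≤order : ∀ v → rank v ≤ order
  rank≤order v = ≤-trans (length-filter (before? v) (allFin order))
                         (≤-reflexive (length-tabulate id))

  between? : ∀ u v → Decidable (λ w → key u ≤ key w × key w < key v)
  between? u v w = (key u ≤? key w) ×-dec (key w <? key v)

  rank-split : ∀ u v → rank v ≤ rank u + count (between? u v)
  rank-split u v = ≤-trans
    (length-mono-⊆ {ys = members (before? u) ++ members (between? u v)}
      (members-unique (before? v)) (split ∘ ∈-members⁻ (before? v)))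
    (≤-reflexive (length-++ (members (before? u))))
    where
    split : ∀ {w} → key w < key v → w ∈ members (before? u) ++ members (between? u v)
    split {w} lt with key w <? key u
    ... | yes w<u = ∈-++⁺ˡ (∈-members⁺ (before? u) w<u)
    ... | no  w≮u = ∈-++⁺ʳ (members (before? u)) (∈-members⁺ (between? u v) (≮⇒≥ w≮u , lt))

  module _ {u v : Vertex} (u~v : Adj u v) (u<v : key u < key v) where
    private
      module S = SpineOf (root u)
      i = foot u

    foot-close : foot v ≤ 2 + foot u
    foot-close = subst (λ r → SpineOf.foot r v ≤ 2 + foot u) (root-adj u~v)
      (S.close (root-reaches u) u~v)

    -- The lexicographic order sandwiches first the root of `w`, which is thus that of `u`, and then
    -- its foot, which is among three consecutive values.
    interval-near : ∀ {w} → key u ≤ key w → key w ≤ key v →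
      Near w (S.at i) ⊎ Near w (S.at (1 + i)) ⊎ Near w (S.at (2 + i))
    interval-near {w} u≤w w≤v
      with ≤2+⇒cases (key⇒foot {u} {w} same u≤w)
                     (≤-trans (key⇒foot {w} {v} (trans (sym same) (root-adj u~v)) w≤v) foot-close)
         | subst (λ r → Near w (SpineOf.at r (foot w))) (sym same)
             (SpineOf.covers (root w) (root-reaches w))
      where
      same : root u ≡ root w
      same = toℕ-injective (≤-antisym (key⇒root {u} {w} u≤w)
        (≤-trans (key⇒root {w} {v} w≤v) (≤-reflexive (cong toℕ (sym (root-adj u~v))))))
    ... | inj₁ eq        | near = inj₁ (subst (Near w ∘ S.at) eq near)
    ... | inj₂ (inj₁ eq) | near = inj₂ (inj₁ (subst (Near w ∘ S.at) eq near))
    ... | inj₂ (inj₂ eq) | near = inj₂ (inj₂ (subst (Near w ∘ S.at) eq near))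

    interval-size : ∀ {δ} → Δ G ≡ suc δ → count (between? u v) ≤ suc δ + (δ + δ)
    interval-size Δ≡ = s≤s⁻¹ (≤-trans
      (length-strictMono-⊆ (members-unique (between? u v))
        (λ w∈ → let u≤w , w<v = ∈-members⁻ (between? u v) w∈
                in ∈-path-nbhd (at~ i) (at~ (1 + i)) (interval-near u≤w (<⇒≤ w<v)))
        -- `v` lies in the neighbourhood but not in the half-open interval, which improves 3Δ - 1 to
        -- 3Δ - 2.
        (∈-path-nbhd (at~ i) (at~ (1 + i)) (interval-near (<⇒≤ u<v) ≤-refl))
        (λ v∈ → <-irrefl refl (proj₂ (∈-members⁻ (between? u v) v∈))))
      (path-nbhd-size (at~ i) (at~ (1 + i)) Δ≡))
      where
      at~ : ∀ j → Adj (S.at j) (S.at (suc j))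
      at~ = S.at-walk (root-reaches u) u~v

  rank-close : ∀ {δ} → Δ G ≡ suc δ → ∀ {u v} → Adj u v → rank v ≤ rank u + (suc δ + (δ + δ))
  rank-close {δ} Δ≡ {u} {v} u~v with key u <? key v
  ... | yes u<v = ≤-trans (rank-split u v) (+-monoʳ-≤ (rank u) (interval-size u~v u<v Δ≡))
  ... | no  u≮v = ≤-trans (rank-mono (≮⇒≥ u≮v)) (m≤m+n (rank u) (suc δ + (δ + δ)))

  cubes : ∀ {δ} → Δ G ≡ suc δ → CubeRepresentable G (suc (suc δ + (δ + δ)))
  -- Here `b′` is 3Δ - 3, so the bandwidth `b` is 3Δ - 2.
  cubes {δ} Δ≡ = bandwidth⇒cubes G (δ + (δ + δ)) rank rank-injective (rank-close Δ≡)
    order (s≤s ∘ rank≤order)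

-- Removing the decidability assumptions

-- Double negation is applicative, so it can be pulled out of finitely many conjuncts.
¬¬-∀ : ∀ {n} {P : Pred (Fin n) 0ℓ} → (∀ i → ¬ ¬ P i) → ¬ ¬ (∀ i → P i)
¬¬-∀ = sequence (RawMonad.rawApplicative ¬¬-Monad)

-- The conclusion is ¬¬-stable, so reachability may be assumed decidable.
corollary3 : (G : Graph) → ATFree G → 1 ≤ Δ G →
    (c : ℕ) → IsCubicity G c → c ≤ 3 * Δ G ∸ 1
corollary3 G at-free 1≤Δ c (_ , minimal) with Δ G in eq
... | suc δ = decidable-stable (c ≤? _) λ c≰ →
  (¬¬-∀ λ u → ¬¬-∀ λ v → ¬¬-excluded-middle) λ reach? →
  (¬¬-∀ λ x → ¬¬-∀ λ u → ¬¬-∀ λ v → ¬¬-excluded-middle) λ walk-away? →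
  c≰ (subst (c ≤_) (sizes δ) (minimal _ (RankOrdering.cubes G reach? walk-away? at-free eq)))
  where
  sizes : ∀ δ → suc (suc δ + (δ + δ)) ≡ δ + (suc δ + (suc δ + 0))
  sizes = solve-∀
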